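{- Let $n=\max(|S|,|S'|)$. Then the running time of Algorithm ED-Approx on input $S,S',N$ and the list-decoder $\mathrm{Dec}_{\mathcal C}$ is $$O\left(\frac{n}{N}\cdot T_{\mathrm{Dec}_{\mathcal C}}(N)+\frac{NL}{\varepsilon}\cdot n\log\log n\right).$$
   Context: Setting. Let $\varepsilon>0$ be sufficiently small and let $\mathcal C$ be an insertion-deletion code over alphabet $\Sigma_{\mathcal C}$ with block length $N$ and rate $r$ that is $L$-list decodable from any $N(1-\varepsilon)$ deletions and $N(1-\varepsilon)$ insertions in time $T_{\mathrm{Dec}_{\mathcal C}}(N)$: given a string $y$ of length $N$, the decoder $\mathrm{Dec}_{\mathcal C}(y)$ outputs, in time $T_{\mathrm{Dec}_{\mathcal C}}(N)$, the set (of size at most $L$) of all indices $j$ such that the $j$-th codeword $\mathcal C(j)$ can be turned into $y$ by at most $N(1-\varepsilon)$ deletions and at most $N(1-\varepsilon)$ insertions. Let $I$ be the concatenation $\mathcal C(1)\mathcal C(2)\cdots$ of all $|\Sigma_{\mathcal C}|^{Nr}$ codewords, $m$ an arbitrary string with $|m|=|I|=N|\Sigma_{\mathcal C}|^{Nr}$, and $S$ the string with $S_i=(m_i,I_i)$. $S'$ is a given string over the same product alphabet. $S$ and $S'$ are split into consecutive blocks of length $N$; $S(i)$, $S'(i)$ denote the $i$-th blocks, and $C'_i$ denotes the index component (over $\Sigma_{\mathcal C}$) of $S'(i)$. Algorithm ED-Approx. Let $w=1/\varepsilon$. Start with an empty bipartite graph $G$ whose two parts are the positions of $S$ and the positions of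 $S'$. For each block $S'(i)$, compute $\mathrm{Dec}_{\mathcal C}(C'_i)$; for each $j$ in this list and each (valid) block index $k\in[j-w,j+w]$, connect all pairs of vertices of $G$ corresponding to identical symbols in $S(k)$ and $S'(i)$. Finally, compute and return a largest non-crossing matching of $G$ (a set of edges $(u_{i_1},v_{j_1}),\dots,(u_{i_t},v_{j_t})$ with $i_1<\dots<i_t$ and $j_1<\dots<j_t$), using the Hunt–Szymanski algorithm, which finds a largest non-crossing matching of a bipartite graph with $n$ ordered vertices in each part and $r$ edges in $O((n+r)\log\log n)$ time. Symbol comparisons are unit cost.
   Formalization: The parameter ε ranges over positive rational numbers below a threshold instead of positive real numbers. -}

module Defs where

open import Data.Bool using (if_then_else_)
open import Data.Fin as Fin using (Fin; toℕ; fromℕ<; combine; inject≤)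
import Data.Fin.Properties as Fin
open import Data.Integer as ℤ using (+_)
open import Data.List using (List; []; _∷_; _++_; length; allFin; upTo)
open import Data.List.Membership.Propositional using (_∈_)
open import Data.List.Relation.Unary.All using (All)
open import Data.List.Relation.Unary.AllPairs using (AllPairs)
open import Data.List.Relation.Unary.Unique.Propositional using (Unique)
open import Data.Maybe using (Maybe; just; nothing)
open import Data.Nat using (ℕ; zero; suc; _+_; _*_; _∸_; _/_; _⊔_; _≤_; _≤?_; _<?_; NonZero)
open import Data.Nat.DivMod using (m/n*n≤m)
open import Data.Nat.Logarithm using (⌊log₂_⌋)
open import Data.Product using (_×_; _,_; proj₂; ∃₂)
open import Data.Product.Properties using (≡-dec)
open import Data.Rational as ℚ using (ℚ; 1ℚ; floor; Positive)
open import Data.Rational.Properties using (pos⇒nonZero)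
open import Data.Vec as Vec using (Vec; []; _∷_; lookup; tabulate; concat; toList)
open import Function using (_∘_)
open import Function.Bundles using (_⇔_)
open import Function.Definitions using (Injective)
open import Relation.Binary.Definitions using (DecidableEquality)
open import Relation.Binary.PropositionalEquality using (_≡_)
open import Relation.Nullary using (yes; no; does)

fromℕ : ℕ → ℚ
fromℕ n = + n ℚ./ 1

inverse : (ε : ℚ) .{{_ : Positive ε}} → ℚ
inverse ε = ℚ.1/_ ε {{pos⇒nonZero ε}}

-- Equal to ⌊log₂ (log₂ n)⌋ for n ≥ 2, hence within a factor of 2 of log₂ log₂ n
-- once n ≥ 4; only used under O(·) and for n above a threshold.
loglog : ℕ → ℕ
loglog n = ⌊log₂ ⌊log₂ n ⌋ ⌋

------------------------------------------------------------------------
-- Unit-cost computations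

record Timed (A : Set) : Set where
  constructor timed
  field
    value : A
    cost  : ℕ

open Timed public

return : {A : Set} → A → Timed A
return x = timed x 0

_>>=_ : {A B : Set} → Timed A → (A → Timed B) → Timed B
x >>= f = timed (value (f (value x))) (cost x + cost (f (value x)))

_>>_ : {A B : Set} → Timed A → Timed B → Timed B
x >> y = x >>= λ _ → y

-- One elementary operation: an arithmetic operation, an array access (including
-- the address computation), a symbol comparison, a list cons.
step : {A : Set} → A → Timed A
step x = timed x 1

read : {A : Set} {n : ℕ} → Vec A n → Fin n → Timed A
read xs i = step (lookup xs i)

fill : {A : Set} {n : ℕ} → (Fin n → Timed A) → Timed (Vec A n)
fill {n = zero}  f = return []
fill {n = suc n} f = do
  x  ← f Fin.zero
  xs ← fill (f ∘ Fin.suc)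
  step (x ∷ xs)

-- Threads an accumulator through the loop body, charging one unit of overhead
-- per iteration.
forEach : {A B : Set} → List A → B → (A → B → Timed B) → Timed B
forEach []       acc body = return acc
forEach (x ∷ xs) acc body = do
  acc₁ ← step acc
  acc₂ ← body x acc₁
  forEach xs acc₂ body

------------------------------------------------------------------------
-- Bipartite graphs and non-crossing matchings

-- The edge list of a bipartite graph with ordered parts of sizes a and b.  A pair
-- may be listed repeatedly; repetitions are counted in the number of edges.
Graph : ℕ → ℕ → Set
Graph a b = List (Fin a × Fin b)

_≺_ : {a b : ℕ} → Fin a × Fin b → Fin a × Fin b → Set
(u , v) ≺ (u′ , v′) = u Fin.< u′ × v Fin.< v′

record NonCrossingMatching {a b : ℕ} (G : Graph a b) (es : List (Fin a × Fin b)) : Set where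
  field
    edges       : All (_∈ G) es
    nonCrossing : AllPairs _≺_ es

record LargestNonCrossingMatching {a b : ℕ} (G : Graph a b) (es : List (Fin a × Fin b)) : Set where
  field
    matching : NonCrossingMatching G es
    largest  : ∀ es′ → NonCrossingMatching G es′ → length es′ ≤ length es

-- The Hunt–Szymanski algorithm, used as a black box: a largest non-crossing
-- matching in time O((n + r) log log n), where n is the size of the larger part
-- (isolated vertices make the parts equal) and r the number of edges.
record HuntSzymanski : Set where
  field
    run     : {a b : ℕ} → Graph a b → Timed (List (Fin a × Fin b))
    correct : {a b : ℕ} (G : Graph a b) → LargestNonCrossingMatching G (value (run G))
    time    : ∃₂ λ c n₀ → ∀ {a b} (G : Graph a b) → n₀ ≤ a ⊔ b →
              cost (run G) ≤ c * ((a ⊔ b + length G) * loglog (a ⊔ b))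

------------------------------------------------------------------------
-- Insertion-deletion codes

-- xs ⇝⟨ d , i ⟩ ys: xs is turned into ys by a sequence of d deletions and i
-- insertions of single symbols.
data _⇝⟨_,_⟩_ {A : Set} : List A → ℕ → ℕ → List A → Set where
  done   : ∀ {xs} → xs ⇝⟨ 0 , 0 ⟩ xs
  delete : ∀ us x vs {d i ys} → (us ++ vs) ⇝⟨ d , i ⟩ ys → (us ++ x ∷ vs) ⇝⟨ suc d , i ⟩ ys
  insert : ∀ us x vs {d i ys} → (us ++ x ∷ vs) ⇝⟨ d , i ⟩ ys → (us ++ vs) ⇝⟨ d , suc i ⟩ ys

-- A code of block length N over an alphabet of q symbols.  Its rate r is given by
-- size = q ^ (N r), so an arbitrary nonzero size is an arbitrary (real) rate.
record Code (q N : ℕ) : Set where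
  field
    size        : ℕ
    nonempty    : NonZero size
    codeword    : Fin size → Vec (Fin q) N
    injective   : Injective _≡_ _≡_ codeword

open Code public

-- y is within N(1 - ε) deletions and N(1 - ε) insertions of x.
Within : {q N : ℕ} → ℚ → Vec (Fin q) N → Vec (Fin q) N → Set
Within {N = N} ε x y = ∃₂ λ d i →
  fromℕ d ℚ.≤ fromℕ N ℚ.* (1ℚ ℚ.- ε) ×
  fromℕ i ℚ.≤ fromℕ N ℚ.* (1ℚ ℚ.- ε) ×
  toList x ⇝⟨ d , i ⟩ toList y

record ListDecoder {q N : ℕ} (C : Code q N) (ε : ℚ) (L : ℕ) (T : ℕ → ℕ) : Set where
  field
    decode   : Vec (Fin q) N → Timed (List (Fin (size C)))
    correct  : ∀ y j → j ∈ value (decode y) ⇔ Within ε (codeword C j) y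
    distinct : ∀ y → Unique (value (decode y))
    listSize : ∀ y → length (value (decode y)) ≤ L
    time     : ∀ y → cost (decode y) ≤ T N

indexString : {q N : ℕ} (C : Code q N) → Vec (Fin q) (size C * N)
indexString C = concat (tabulate (codeword C))

indexed : {A : Set} {q N : ℕ} (C : Code q N) → Vec A (size C * N) → Vec (A × Fin q) (size C * N)
indexed C m = Vec.zip m (indexString C)

------------------------------------------------------------------------
-- The algorithm

module _ {A : Set} (_≟_ : DecidableEquality A) {q M n′ : ℕ}
         (ε : ℚ) .{{_ : Positive ε}} (N : ℕ) .{{_ : NonZero N}}
         (S : Vec (A × Fin q) (M * N)) (S′ : Vec (A × Fin q) n′)
         (dec : Vec (Fin q) N → Timed (List (Fin M)))
         (hs : HuntSzymanski)
         where

  G[S,S′] : Set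
  G[S,S′] = Graph (M * N) n′

  -- The p-th position of the block S(k).
  position : Fin M → Fin N → Fin (M * N)
  position k p = combine k p

  -- The p-th position of the block S′(i).  Fewer than N trailing symbols of S′
  -- may lie outside all blocks; they are isolated vertices of the graph.
  position′ : Fin (n′ / N) → Fin N → Fin n′
  position′ i p = inject≤ (combine i p) (m/n*n≤m n′ N)

  emptyGraph : Timed G[S,S′]
  emptyGraph = timed [] (M * N + n′)

  connectIfEqual : Fin (M * N) → Fin n′ → G[S,S′] → Timed G[S,S′]
  connectIfEqual u v G = do
    s     ← read S u
    s′    ← read S′ v
    equal ← step (does (≡-dec _≟_ Fin._≟_ s s′))
    if equal then step ((u , v) ∷ G) else return G

  connectBlocks : Fin M → Fin (n′ / N) → G[S,S′] → Timed G[S,S′]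
  connectBlocks k i G =
    forEach (allFin N) G λ p G₁ →
    forEach (allFin N) G₁ λ p′ G₂ →
    connectIfEqual (position k p) (position′ i p′) G₂

  -- The block index k = j + t - W, if it is valid.
  blockIndex : (W : ℕ) → Fin M → (t : ℕ) → Maybe (Fin M)
  blockIndex W j t with W ≤? toℕ j + t | toℕ j + t ∸ W <? M
  ... | yes _ | yes k<M = just (fromℕ< k<M)
  ... | yes _ | no  _   = nothing
  ... | no  _ | _       = nothing

  connectIfValid : Maybe (Fin M) → Fin (n′ / N) → G[S,S′] → Timed G[S,S′]
  connectIfValid (just k) i G = connectBlocks k i G
  connectIfValid nothing  i G = return G

  -- With W = ⌊w⌋, the integers in [j - w, j + w] are j + t - W for 0 ≤ t ≤ 2W.
  connectWindow : (W : ℕ) → Fin M → Fin (n′ / N) → G[S,S′] → Timed G[S,S′]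
  connectWindow W j i G =
    forEach (upTo (suc (2 * W))) G λ t G₁ → do
      k ← step (blockIndex W j t)
      connectIfValid k i G₁

  indexComponent : Fin (n′ / N) → Timed (Vec (Fin q) N)
  indexComponent i = fill λ p → do
    s′ ← read S′ (position′ i p)
    step (proj₂ s′)

  edApprox : Timed (List (Fin (M * N) × Fin n′))
  edApprox = do
    w  ← step (inverse ε)
    W  ← step ℤ.∣ floor w ∣
    is ← step (allFin (n′ / N))
    G₀ ← emptyGraph
    G  ← forEach is G₀ λ i G₁ → do
           C′ ← indexComponent i
           js ← dec C′
           forEach js G₁ λ j G₂ → connectWindow W j i G₂
    HuntSzymanski.run hs G

{-# OPTIONS --safe #-}
-- Comparing two blocks costs O(N²), so treating one block of S′ costs T(N) + O(N² L w) and adds at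
-- most N² L (2w + 1) edges; there are at most n/N such blocks, whence O((n/N) T(N) + N L w n) time
-- and O(N L w n) edges, on which Hunt–Szymanski spends O(N L w n log log n).  The lower-order terms
-- are absorbed because N, L, w, log log n ≥ 1; for L this uses that every codeword is within zero
-- edits of itself, so that some decoded list is nonempty.
module Submission where

open import Defs
open import Data.Bool using (true; false)
open import Data.Fin as Fin using (Fin; fromℕ<)
open import Data.Integer as ℤ using (+_; +≤+)
import Data.Integer.DivMod as ℤ
import Data.Integer.Properties as ℤ
open import Data.List using (List; []; _∷_; length; allFin; upTo)
open import Data.List.Membership.Propositional using (_∈_)
open import Data.List.Properties using (length-tabulate; length-upTo)
open import Data.List.Relation.Unary.Any using (here; there)
open import Data.Maybe using (just; nothing)
open import Data.Nat as ℕ using (ℕ; zero; suc; NonZero; _⊔_; z≤n; s≤s)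
open import Data.Nat.DivMod using (m/n*n≤m)
open import Data.Nat.Logarithm using (⌊log₂⌋-mono-≤)
import Data.Nat.Properties as ℕ
open import Data.Nat.Tactic.RingSolver using (solve-∀)
open import Data.Product using (_×_; _,_; ∃-syntax)
open import Data.Product.Properties using (≡-dec)
open import Data.Rational using (ℚ; mkℚ; 0ℚ; 1ℚ; Positive; NonNegative; floor; toℚᵘ; *<*)
open import Data.Rational using (_≤_; _<_; _+_; _*_; _-_; -_; _/_)
import Data.Rational.Properties as ℚ
open import Data.Rational.Solver using (module +-*-Solver)
open import Data.Rational.Unnormalised as ℚᵘ using (mkℚᵘ; *≡*; *≤*)
import Data.Rational.Unnormalised.Properties as ℚᵘ
open import Data.Vec using (Vec; lookup)
open import Function using (_∘_)
open import Function.Bundles using (Equivalence)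
open import Relation.Binary.Definitions using (DecidableEquality)
open import Relation.Binary.PropositionalEquality using (_≡_; refl; sym; trans; cong; cong₂; subst)
open import Relation.Nullary using (does)

-- Costs of loops

fill-cost : ∀ {A : Set} {n c} {f : Fin n → Timed A} →
            (∀ i → cost (f i) ℕ.≤ c) → cost (fill f) ℕ.≤ n ℕ.* (c ℕ.+ 1)
fill-cost {n = zero}  f≤c = z≤n
fill-cost {n = suc n} {c} {f} f≤c = begin
  cost (f Fin.zero) ℕ.+ (cost (fill (f ∘ Fin.suc)) ℕ.+ 1)
    ≤⟨ ℕ.+-mono-≤ (f≤c Fin.zero) (ℕ.+-monoˡ-≤ 1 (fill-cost (f≤c ∘ Fin.suc))) ⟩
  c ℕ.+ (n ℕ.* (c ℕ.+ 1) ℕ.+ 1)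
    ≡⟨ rearrange c (n ℕ.* (c ℕ.+ 1)) ⟩
  suc n ℕ.* (c ℕ.+ 1) ∎
  where
  open ℕ.≤-Reasoning
  rearrange : ∀ c x → c ℕ.+ (x ℕ.+ 1) ≡ (c ℕ.+ 1) ℕ.+ x
  rearrange = solve-∀

-- The successor is the unit of overhead charged per iteration. The length enters only through an
-- upper bound `k`, since a decoded list is merely known to have at most `L` entries.
forEach-cost : ∀ {A B : Set} (xs : List A) {acc : B} {body : A → B → Timed B} {c k} →
               length xs ℕ.≤ k → (∀ x acc → cost (body x acc) ℕ.≤ c) →
               cost (forEach xs acc body) ℕ.≤ k ℕ.* suc c
forEach-cost []       _         body≤c = z≤n
forEach-cost (x ∷ xs) (s≤s len) body≤c =
  s≤s (ℕ.+-mono-≤ (body≤c x _) (forEach-cost xs len body≤c))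

-- Here the accumulator is the growing edge list. The increment `e` is uniform in the accumulator,
-- so the bound for an inner loop serves as the hypothesis for the outer one.
forEach-length : ∀ {A B : Set} (xs : List A) {acc : List B} {body : A → List B → Timed (List B)} {e k} →
                 length xs ℕ.≤ k → (∀ x acc → length (value (body x acc)) ℕ.≤ length acc ℕ.+ e) →
                 length (value (forEach xs acc body)) ℕ.≤ length acc ℕ.+ k ℕ.* e
forEach-length []       {acc} _ body≤e = ℕ.m≤m+n (length acc) _
forEach-length (x ∷ xs) {acc} {body} {e} {suc k} (s≤s len) body≤e = begin
  length (value (forEach xs (value (body x acc)) body)) ≤⟨ forEach-length xs len body≤e ⟩
  length (value (body x acc)) ℕ.+ k ℕ.* e              ≤⟨ ℕ.+-monoˡ-≤ (k ℕ.* e) (body≤e x acc) ⟩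
  length acc ℕ.+ e ℕ.+ k ℕ.* e                         ≡⟨ ℕ.+-assoc (length acc) e (k ℕ.* e) ⟩
  length acc ℕ.+ suc k ℕ.* e                           ∎
  where open ℕ.≤-Reasoning

length-allFin : ∀ n → length (allFin n) ≡ n
length-allFin n = length-tabulate (λ i → i)

∈⇒0<length : ∀ {A : Set} {x : A} {xs} → x ∈ xs → 0 ℕ.< length xs
∈⇒0<length (here _)  = s≤s z≤n
∈⇒0<length (there _) = s≤s z≤n

-- Costs of the algorithm

compareCost blockEdges windowSize : ℕ → ℕ
compareCost N = N ℕ.* (1 ℕ.+ N ℕ.* 5)
blockEdges N = N ℕ.* (N ℕ.* 1)
windowSize W = suc (2 ℕ.* W)

-- One block of `S′`: reading off the index component, decoding in time `t`, then at most `L`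
-- windows of `V` blocks. The 2 is the loop overhead plus the computation of the block index.
bodyCost : (N L V t : ℕ) → ℕ
bodyCost N L V t = N ℕ.* 3 ℕ.+ (t ℕ.+ L ℕ.* suc (V ℕ.* (2 ℕ.+ compareCost N)))

module _ {A : Set} (_≟_ : DecidableEquality A) {q M n′ : ℕ}
         (ε : ℚ) .{{_ : Positive ε}} (N : ℕ) .{{_ : NonZero N}}
         (S : Vec (A × Fin q) (M ℕ.* N)) (S′ : Vec (A × Fin q) n′)
         (dec : Vec (Fin q) N → Timed (List (Fin M)))
         (hs : HuntSzymanski)
         where

  private
    connectIfEqual′ = connectIfEqual _≟_ ε N S S′ dec hs
    connectBlocks′  = connectBlocks _≟_ ε N S S′ dec hs
    connectIfValid′ = connectIfValid _≟_ ε N S S′ dec hs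
    connectWindow′  = connectWindow _≟_ ε N S S′ dec hs
    indexComponent′ = indexComponent _≟_ ε N S S′ dec hs

  -- Two reads, one comparison and, for equal symbols, one cons.
  connectIfEqual-cost : ∀ u v G → cost (connectIfEqual′ u v G) ℕ.≤ 4
  connectIfEqual-cost u v G with does (≡-dec _≟_ Fin._≟_ (lookup S u) (lookup S′ v))
  ... | true  = ℕ.≤-refl
  ... | false = ℕ.n≤1+n 3

  connectIfEqual-length : ∀ u v G → length (value (connectIfEqual′ u v G)) ℕ.≤ length G ℕ.+ 1
  connectIfEqual-length u v G with does (≡-dec _≟_ Fin._≟_ (lookup S u) (lookup S′ v))
  ... | true  = ℕ.≤-reflexive (ℕ.+-comm 1 (length G))
  ... | false = ℕ.m≤m+n (length G) 1

  connectBlocks-cost : ∀ k i G → cost (connectBlocks′ k i G) ℕ.≤ compareCost N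
  connectBlocks-cost k i G =
    forEach-cost (allFin N) (ℕ.≤-reflexive (length-allFin N)) λ p G₁ →
    forEach-cost (allFin N) (ℕ.≤-reflexive (length-allFin N)) λ p′ G₂ →
    connectIfEqual-cost _ _ G₂

  connectBlocks-length : ∀ k i G → length (value (connectBlocks′ k i G)) ℕ.≤ length G ℕ.+ blockEdges N
  connectBlocks-length k i G =
    forEach-length (allFin N) (ℕ.≤-reflexive (length-allFin N)) λ p G₁ →
    forEach-length (allFin N) (ℕ.≤-reflexive (length-allFin N)) λ p′ G₂ →
    connectIfEqual-length _ _ G₂

  connectIfValid-cost : ∀ k i G → cost (connectIfValid′ k i G) ℕ.≤ compareCost N
  connectIfValid-cost (just k) i G = connectBlocks-cost k i G
  connectIfValid-cost nothing  i G = z≤n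

  connectIfValid-length : ∀ k i G → length (value (connectIfValid′ k i G)) ℕ.≤ length G ℕ.+ blockEdges N
  connectIfValid-length (just k) i G = connectBlocks-length k i G
  connectIfValid-length nothing  i G = ℕ.m≤m+n (length G) _

  connectWindow-cost : ∀ W j i G →
    cost (connectWindow′ W j i G) ℕ.≤ windowSize W ℕ.* (2 ℕ.+ compareCost N)
  connectWindow-cost W j i G =
    forEach-cost (upTo (windowSize W)) (ℕ.≤-reflexive (length-upTo (windowSize W))) λ t G₁ →
    s≤s (connectIfValid-cost (blockIndex _≟_ ε N S S′ dec hs W j t) i G₁)

  connectWindow-length : ∀ W j i G →
    length (value (connectWindow′ W j i G)) ℕ.≤ length G ℕ.+ windowSize W ℕ.* blockEdges N
  connectWindow-length W j i G =
    forEach-length (upTo (windowSize W)) (ℕ.≤-reflexive (length-upTo (windowSize W))) λ t G₁ →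
    connectIfValid-length (blockIndex _≟_ ε N S S′ dec hs W j t) i G₁

  indexComponent-cost : ∀ i → cost (indexComponent′ i) ℕ.≤ N ℕ.* 3
  indexComponent-cost i = fill-cost {n = N} {c = 2} (λ _ → ℕ.≤-refl)

  -- The unsimplified sum: three initial steps, the empty graph, the loop over the blocks of `S′`,
  -- and the Hunt-Szymanski call.
  edApprox-cost : ∀ {L t c n₀} →
    (∀ y → length (value (dec y)) ℕ.≤ L) → (∀ y → cost (dec y) ℕ.≤ t) →
    (∀ {a b} (G : Graph a b) → n₀ ℕ.≤ a ⊔ b →
       cost (HuntSzymanski.run hs G) ℕ.≤ c ℕ.* ((a ⊔ b ℕ.+ length G) ℕ.* loglog (a ⊔ b))) →
    let n = (M ℕ.* N) ⊔ n′
        B = n′ ℕ./ N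
        V = windowSize ℤ.∣ floor (inverse ε) ∣
    in n₀ ℕ.≤ n →
       cost (edApprox _≟_ ε N S S′ dec hs)
         ℕ.≤ 3 ℕ.+ (M ℕ.* N ℕ.+ n′ ℕ.+ (B ℕ.* suc (bodyCost N L V t)
               ℕ.+ c ℕ.* ((n ℕ.+ B ℕ.* (L ℕ.* (V ℕ.* blockEdges N))) ℕ.* loglog n)))
  edApprox-cost {L} {t} {c} listSize decTime hsTime n₀≤n =
    s≤s (s≤s (s≤s (ℕ.+-monoʳ-≤ (M ℕ.* N ℕ.+ n′) (ℕ.+-mono-≤
      (forEach-cost (allFin B) allB λ i G →
        ℕ.+-mono-≤ (indexComponent-cost i) (ℕ.+-mono-≤ (decTime _)
          (forEach-cost (value (dec _)) (listSize _) λ j G₂ → connectWindow-cost W j i G₂)))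
      -- The Hunt-Szymanski bound is monotone in the number of edges, so the edge count may be
      -- replaced by its upper bound.
      (ℕ.≤-trans (hsTime _ n₀≤n)
        (ℕ.*-monoʳ-≤ c (ℕ.*-monoˡ-≤ (loglog n) (ℕ.+-monoʳ-≤ n
          (forEach-length (allFin B) allB λ i G →
            forEach-length (value (dec _)) (listSize _) λ j G₂ → connectWindow-length W j i G₂)))))))))
    where
    n = (M ℕ.* N) ⊔ n′
    B = n′ ℕ./ N
    W = ℤ.∣ floor (inverse ε) ∣
    allB : length (allFin B) ℕ.≤ B
    allB = ℕ.≤-reflexive (length-allFin B)

-- Absorbing the lower-order terms

-- Evaluation gives `loglog 4 = 1`, and both logarithms are monotone.
loglog-positive : ∀ {n} → 4 ℕ.≤ n → 1 ℕ.≤ loglog n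
loglog-positive 4≤n = ⌊log₂⌋-mono-≤ (⌊log₂⌋-mono-≤ 4≤n)

-- Decoding keeps coefficient 1; everything else is padded up to a multiple of N²LV by factors that
-- are at least 1. The constant is 4 for the index component and loop overhead, plus 9 for the
-- windows.
bodyCost-bound : ∀ {N L V} t → 1 ℕ.≤ N → 1 ℕ.≤ L → 1 ℕ.≤ V →
                 suc (bodyCost N L V t) ℕ.≤ t ℕ.+ 13 ℕ.* (N ℕ.* (N ℕ.* L ℕ.* V))
-- Matching on successors supplies the `NonZero` instances for the padding steps.
bodyCost-bound {N@(suc a)} {L@(suc b)} {V@(suc d)} t _ _ _ = begin
  suc (bodyCost N L V t)
    ≡⟨ regroup N t (L ℕ.* suc (V ℕ.* (2 ℕ.+ compareCost N))) ⟩
  t ℕ.+ ((1 ℕ.+ N ℕ.* 3) ℕ.+ L ℕ.* suc (V ℕ.* (2 ℕ.+ compareCost N)))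
    ≤⟨ ℕ.+-monoʳ-≤ t (ℕ.+-mono-≤ indexing (ℕ.*-monoʳ-≤ L window)) ⟩
  t ℕ.+ (4 ℕ.* (N ℕ.* (N ℕ.* L ℕ.* V)) ℕ.+ L ℕ.* (9 ℕ.* (V ℕ.* (N ℕ.* N))))
    ≡⟨ cong (t ℕ.+_) (collect N L V) ⟩
  t ℕ.+ 13 ℕ.* (N ℕ.* (N ℕ.* L ℕ.* V)) ∎
  where
  open ℕ.≤-Reasoning
  regroup : ∀ N t x → suc (N ℕ.* 3 ℕ.+ (t ℕ.+ x)) ≡ t ℕ.+ ((1 ℕ.+ N ℕ.* 3) ℕ.+ x)
  regroup = solve-∀
  collect : ∀ N L V → 4 ℕ.* (N ℕ.* (N ℕ.* L ℕ.* V)) ℕ.+ L ℕ.* (9 ℕ.* (V ℕ.* (N ℕ.* N)))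
                    ≡ 13 ℕ.* (N ℕ.* (N ℕ.* L ℕ.* V))
  collect = solve-∀
  four : ∀ N → N ℕ.+ N ℕ.* 3 ≡ 4 ℕ.* N
  four = solve-∀
  eight : ∀ N → 2 ℕ.* (N ℕ.* N) ℕ.+ (N ℕ.* N ℕ.+ N ℕ.* (N ℕ.* 5)) ≡ 8 ℕ.* (N ℕ.* N)
  eight = solve-∀
  nine : ∀ V x → V ℕ.* x ℕ.+ V ℕ.* (8 ℕ.* x) ≡ 9 ℕ.* (V ℕ.* x)
  nine = solve-∀
  indexing : 1 ℕ.+ N ℕ.* 3 ℕ.≤ 4 ℕ.* (N ℕ.* (N ℕ.* L ℕ.* V))
  indexing = begin
    1 ℕ.+ N ℕ.* 3 ≤⟨ ℕ.+-monoˡ-≤ (N ℕ.* 3) (s≤s z≤n) ⟩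
    N ℕ.+ N ℕ.* 3 ≡⟨ four N ⟩
    4 ℕ.* N       ≤⟨ ℕ.*-monoʳ-≤ 4 (ℕ.m≤m*n N (N ℕ.* L ℕ.* V)) ⟩
    4 ℕ.* (N ℕ.* (N ℕ.* L ℕ.* V)) ∎
  comparing : 2 ℕ.+ compareCost N ℕ.≤ 8 ℕ.* (N ℕ.* N)
  comparing = begin
    2 ℕ.+ N ℕ.* (1 ℕ.+ N ℕ.* 5)
      ≡⟨ cong (2 ℕ.+_) (trans (ℕ.*-distribˡ-+ N 1 (N ℕ.* 5)) (cong (ℕ._+ N ℕ.* (N ℕ.* 5)) (ℕ.*-identityʳ N))) ⟩
    2 ℕ.+ (N ℕ.+ N ℕ.* (N ℕ.* 5))
      ≤⟨ ℕ.+-mono-≤ (ℕ.*-monoʳ-≤ 2 {1} {N ℕ.* N} (s≤s z≤n)) (ℕ.+-monoˡ-≤ (N ℕ.* (N ℕ.* 5)) (ℕ.m≤m*n N N)) ⟩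
    2 ℕ.* (N ℕ.* N) ℕ.+ (N ℕ.* N ℕ.+ N ℕ.* (N ℕ.* 5))
      ≡⟨ eight N ⟩
    8 ℕ.* (N ℕ.* N) ∎
  window : suc (V ℕ.* (2 ℕ.+ compareCost N)) ℕ.≤ 9 ℕ.* (V ℕ.* (N ℕ.* N))
  window = begin
    1 ℕ.+ V ℕ.* (2 ℕ.+ compareCost N)
      ≤⟨ ℕ.+-mono-≤ {1} {V ℕ.* (N ℕ.* N)} (s≤s z≤n) (ℕ.*-monoʳ-≤ V comparing) ⟩
    V ℕ.* (N ℕ.* N) ℕ.+ V ℕ.* (8 ℕ.* (N ℕ.* N))
      ≡⟨ nine V (N ℕ.* N) ⟩
    9 ℕ.* (V ℕ.* (N ℕ.* N)) ∎

-- The key is `B * N ≤ n`: over all `B` blocks, one factor `N` of the quadratic comparison cost is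
-- traded for `n`. In the constant, 18 is 3 + 1 + 1 from the initial steps and the empty graph plus
-- 13 from the blocks; `2 * c` arises since vertices and edges are each at most `n * Y`.
totalCost-bound : ∀ {N L V B a b n ℓ} t c → 1 ℕ.≤ N → 1 ℕ.≤ L → 1 ℕ.≤ V → 1 ℕ.≤ n → 1 ℕ.≤ ℓ →
  B ℕ.* N ℕ.≤ n → a ℕ.≤ n → b ℕ.≤ n →
  3 ℕ.+ (a ℕ.+ b ℕ.+ (B ℕ.* suc (bodyCost N L V t)
    ℕ.+ c ℕ.* ((n ℕ.+ B ℕ.* (L ℕ.* (V ℕ.* blockEdges N))) ℕ.* ℓ)))
  ℕ.≤ B ℕ.* t ℕ.+ (18 ℕ.+ 2 ℕ.* c) ℕ.* (N ℕ.* L ℕ.* V ℕ.* (n ℕ.* ℓ))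
totalCost-bound {N@(suc _)} {L@(suc _)} {V@(suc _)} {B} {a} {b} {n} {ℓ@(suc _)} t c
    1≤N 1≤L 1≤V 1≤n _ BN≤n a≤n b≤n = begin
  3 ℕ.+ (a ℕ.+ b ℕ.+ (B ℕ.* suc (bodyCost N L V t) ℕ.+ c ℕ.* ((n ℕ.+ E) ℕ.* ℓ)))
    ≤⟨ ℕ.+-mono-≤ (ℕ.*-monoʳ-≤ 3 1≤n) (ℕ.+-mono-≤ (ℕ.+-mono-≤ a≤n b≤n)
         (ℕ.+-mono-≤ blocks (ℕ.*-monoʳ-≤ c (ℕ.*-monoˡ-≤ ℓ (ℕ.+-mono-≤ n≤nY edges))))) ⟩
  3 ℕ.* n ℕ.+ (n ℕ.+ n ℕ.+ (B ℕ.* t ℕ.+ 13 ℕ.* (n ℕ.* Y) ℕ.+ c ℕ.* ((n ℕ.* Y ℕ.+ n ℕ.* Y) ℕ.* ℓ)))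
    ≡⟨ regroup n (B ℕ.* t) (n ℕ.* Y) c ℓ ⟩
  B ℕ.* t ℕ.+ (5 ℕ.* n ℕ.+ 13 ℕ.* (n ℕ.* Y) ℕ.+ 2 ℕ.* c ℕ.* (n ℕ.* Y ℕ.* ℓ))
    ≤⟨ ℕ.+-monoʳ-≤ (B ℕ.* t) (ℕ.+-monoˡ-≤ (2 ℕ.* c ℕ.* (n ℕ.* Y ℕ.* ℓ))
         (ℕ.+-mono-≤ (ℕ.*-monoʳ-≤ 5 (ℕ.≤-trans n≤nY (ℕ.m≤m*n (n ℕ.* Y) ℓ)))
                     (ℕ.*-monoʳ-≤ 13 (ℕ.m≤m*n (n ℕ.* Y) ℓ)))) ⟩
  B ℕ.* t ℕ.+ (5 ℕ.* (n ℕ.* Y ℕ.* ℓ) ℕ.+ 13 ℕ.* (n ℕ.* Y ℕ.* ℓ) ℕ.+ 2 ℕ.* c ℕ.* (n ℕ.* Y ℕ.* ℓ))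
    ≡⟨ cong (B ℕ.* t ℕ.+_) (collect n Y c ℓ) ⟩
  B ℕ.* t ℕ.+ (18 ℕ.+ 2 ℕ.* c) ℕ.* (Y ℕ.* (n ℕ.* ℓ)) ∎
  where
  open ℕ.≤-Reasoning
  Y E : ℕ
  Y = N ℕ.* L ℕ.* V
  E = B ℕ.* (L ℕ.* (V ℕ.* blockEdges N))
  n≤nY : n ℕ.≤ n ℕ.* Y
  n≤nY = ℕ.m≤m*n n Y
  regroup : ∀ n b x c ℓ → 3 ℕ.* n ℕ.+ (n ℕ.+ n ℕ.+ (b ℕ.+ 13 ℕ.* x ℕ.+ c ℕ.* ((x ℕ.+ x) ℕ.* ℓ)))
                        ≡ b ℕ.+ (5 ℕ.* n ℕ.+ 13 ℕ.* x ℕ.+ 2 ℕ.* c ℕ.* (x ℕ.* ℓ))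
  regroup = solve-∀
  collect : ∀ n Y c ℓ → 5 ℕ.* (n ℕ.* Y ℕ.* ℓ) ℕ.+ 13 ℕ.* (n ℕ.* Y ℕ.* ℓ) ℕ.+ 2 ℕ.* c ℕ.* (n ℕ.* Y ℕ.* ℓ)
                      ≡ (18 ℕ.+ 2 ℕ.* c) ℕ.* (Y ℕ.* (n ℕ.* ℓ))
  collect = solve-∀
  expand : ∀ B N t Y → B ℕ.* (t ℕ.+ 13 ℕ.* (N ℕ.* Y)) ≡ B ℕ.* t ℕ.+ 13 ℕ.* (B ℕ.* N ℕ.* Y)
  expand = solve-∀
  edgeCount : ∀ B N L V → B ℕ.* (L ℕ.* (V ℕ.* (N ℕ.* (N ℕ.* 1)))) ≡ B ℕ.* N ℕ.* (N ℕ.* L ℕ.* V)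
  edgeCount = solve-∀
  blocks : B ℕ.* suc (bodyCost N L V t) ℕ.≤ B ℕ.* t ℕ.+ 13 ℕ.* (n ℕ.* Y)
  blocks = begin
    B ℕ.* suc (bodyCost N L V t)           ≤⟨ ℕ.*-monoʳ-≤ B (bodyCost-bound t 1≤N 1≤L 1≤V) ⟩
    B ℕ.* (t ℕ.+ 13 ℕ.* (N ℕ.* Y))         ≡⟨ expand B N t Y ⟩
    B ℕ.* t ℕ.+ 13 ℕ.* (B ℕ.* N ℕ.* Y)
      ≤⟨ ℕ.+-monoʳ-≤ (B ℕ.* t) (ℕ.*-monoʳ-≤ 13 (ℕ.*-monoˡ-≤ Y BN≤n)) ⟩
    B ℕ.* t ℕ.+ 13 ℕ.* (n ℕ.* Y)           ∎
  edges : E ℕ.≤ n ℕ.* Y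
  edges = ℕ.≤-trans (ℕ.≤-reflexive (edgeCount B N L V)) (ℕ.*-monoˡ-≤ Y BN≤n)

-- Rational estimates

-- `fromℕ` normalises by a gcd, which is stuck on a variable. Passing to unnormalised rationals
-- reduces the arithmetic below to integer identities.
toℚᵘ-fromℕ : ∀ n → toℚᵘ (fromℕ n) ℚᵘ.≃ mkℚᵘ (+ n) 0
toℚᵘ-fromℕ n = ℚ.toℚᵘ-fromℚᵘ (mkℚᵘ (+ n) 0)

fromℕ-+ : ∀ m n → fromℕ (m ℕ.+ n) ≡ fromℕ m + fromℕ n
fromℕ-+ m n = ℚ.toℚᵘ-injective (begin
  _                               ≈⟨ toℚᵘ-fromℕ (m ℕ.+ n) ⟩
  mkℚᵘ (+ (m ℕ.+ n)) 0            ≈⟨ *≡* (cong (ℤ._* + 1)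
                                       (sym (cong₂ ℤ._+_ (ℤ.*-identityʳ (+ m)) (ℤ.*-identityʳ (+ n))))) ⟩
  mkℚᵘ (+ m) 0 ℚᵘ.+ mkℚᵘ (+ n) 0  ≈⟨ ℚᵘ.+-cong (toℚᵘ-fromℕ m) (toℚᵘ-fromℕ n) ⟨
  _                               ≈⟨ ℚ.toℚᵘ-homo-+ (fromℕ m) (fromℕ n) ⟨
  _                               ∎)
  where open ℚᵘ.≃-Reasoning

fromℕ-* : ∀ m n → fromℕ (m ℕ.* n) ≡ fromℕ m * fromℕ n
fromℕ-* m n = ℚ.toℚᵘ-injective (begin
  _                               ≈⟨ toℚᵘ-fromℕ (m ℕ.* n) ⟩
  mkℚᵘ (+ (m ℕ.* n)) 0            ≈⟨ *≡* (cong (ℤ._* + 1) (ℤ.pos-* m n)) ⟩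
  mkℚᵘ (+ m) 0 ℚᵘ.* mkℚᵘ (+ n) 0  ≈⟨ ℚᵘ.*-cong (toℚᵘ-fromℕ m) (toℚᵘ-fromℕ n) ⟨
  _                               ≈⟨ ℚ.toℚᵘ-homo-* (fromℕ m) (fromℕ n) ⟨
  _                               ∎)
  where open ℚᵘ.≃-Reasoning

-- Cross-multiplication. Used with `d = N` for the number of blocks and with `d = 1` for
-- monotonicity of `fromℕ`.
fromℕ≤/ : ∀ {k n} d .{{_ : NonZero d}} → k ℕ.* d ℕ.≤ n → fromℕ k ≤ + n / d
fromℕ≤/ {k} {n} d@(suc d-1) kd≤n = ℚ.toℚᵘ-cancel-≤ (begin
  _                ≃⟨ toℚᵘ-fromℕ k ⟩
  mkℚᵘ (+ k) 0     ≤⟨ *≤* (subst (ℤ._≤ + n ℤ.* + 1) (ℤ.pos-* k d)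
                        (subst (+ (k ℕ.* d) ℤ.≤_) (sym (ℤ.*-identityʳ (+ n))) (+≤+ kd≤n))) ⟩
  mkℚᵘ (+ n) d-1   ≃⟨ ℚ.toℚᵘ-fromℚᵘ (mkℚᵘ (+ n) d-1) ⟨
  _                ∎)
  where open ℚᵘ.≤-Reasoning

fromℕ-mono-≤ : ∀ {m n} → m ℕ.≤ n → fromℕ m ≤ fromℕ n
fromℕ-mono-≤ {m} m≤n = fromℕ≤/ {m} 1 (ℕ.≤-trans (ℕ.≤-reflexive (ℕ.*-identityʳ m)) m≤n)

*-monoˡ-≤-fromℕ : ∀ n {p q} → p ≤ q → fromℕ n * p ≤ fromℕ n * q
*-monoˡ-≤-fromℕ n = ℚ.*-monoˡ-≤-nonNeg (fromℕ n) {{ℚ.normalize-nonNeg n 1}}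

*-monoʳ-≤-fromℕ : ∀ n {p q} → p ≤ q → p * fromℕ n ≤ q * fromℕ n
*-monoʳ-≤-fromℕ n = ℚ.*-monoʳ-≤-nonNeg (fromℕ n) {{ℚ.normalize-nonNeg n 1}}

-- The floor of a nonnegative rational is nonnegative, so the absolute value leaves it unchanged.
∣floor∣≤ : ∀ p .{{_ : NonNegative p}} → fromℕ ℤ.∣ floor p ∣ ≤ p
∣floor∣≤ p@(mkℚ (+ a) d-1 _) = ℚ.toℚᵘ-cancel-≤ (begin
  _                           ≃⟨ toℚᵘ-fromℕ ℤ.∣ floor p ∣ ⟩
  mkℚᵘ (+ ℤ.∣ floor p ∣) 0    ≡⟨ cong (λ z → mkℚᵘ z 0) (ℤ.0≤i⇒+∣i∣≡i 0≤floor) ⟩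
  mkℚᵘ (floor p) 0            ≤⟨ *≤* (subst (floor p ℤ.* + suc d-1 ℤ.≤_) (sym (ℤ.*-identityʳ (+ a)))
                                   (ℤ.[n/d]*d≤n (+ a) (+ suc d-1))) ⟩
  mkℚᵘ (+ a) d-1              ∎)
  where
  open ℚᵘ.≤-Reasoning
  0≤floor : ℤ.0ℤ ℤ.≤ floor p
  0≤floor = ℤ.0≤n⇒0≤n/d (+ a) (+ suc d-1) (+≤+ z≤n) (+≤+ z≤n)

inverse-nonNeg : ∀ ε .{{_ : Positive ε}} → NonNegative (inverse ε)
inverse-nonNeg ε = ℚ.pos⇒nonNeg (inverse ε) {{ℚ.1/pos⇒pos ε}}

1≤inverse : ∀ ε .{{_ : Positive ε}} → ε ≤ 1ℚ → 1ℚ ≤ inverse ε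
1≤inverse ε ε≤1 = begin
  1ℚ               ≡⟨ ℚ.*-inverseʳ ε {{ℚ.pos⇒nonZero ε}} ⟨
  ε * inverse ε    ≤⟨ ℚ.*-monoʳ-≤-nonNeg (inverse ε) {{inverse-nonNeg ε}} ε≤1 ⟩
  1ℚ * inverse ε   ≡⟨ ℚ.*-identityˡ (inverse ε) ⟩
  inverse ε        ∎
  where open ℚ.≤-Reasoning

-- The centre of the window, the summand 1, is absorbed by `1 ≤ inverse ε`; hence 3 = 1 + 2.
windowSize-bound : ∀ ε .{{_ : Positive ε}} → ε ≤ 1ℚ →
                   fromℕ (windowSize ℤ.∣ floor (inverse ε) ∣) ≤ fromℕ 3 * inverse ε
windowSize-bound ε ε≤1 = begin
  fromℕ (1 ℕ.+ 2 ℕ.* W)      ≡⟨ trans (fromℕ-+ 1 (2 ℕ.* W)) (cong (λ x → 1ℚ + x) (fromℕ-* 2 W)) ⟩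
  1ℚ + fromℕ 2 * fromℕ W     ≤⟨ ℚ.+-mono-≤ (1≤inverse ε ε≤1)
                                  (*-monoˡ-≤-fromℕ 2 (∣floor∣≤ w {{inverse-nonNeg ε}})) ⟩
  w + fromℕ 2 * w            ≡⟨ solve 1 (λ w → w :+ con (fromℕ 2) :* w := con (fromℕ 3) :* w) refl w ⟩
  fromℕ 3 * w                ∎
  where
  open ℚ.≤-Reasoning
  open +-*-Solver
  w = inverse ε
  W = ℤ.∣ floor w ∣

-- Decoding a codeword itself returns its own index: zero edits lie within the radius, which is
-- nonnegative because `ε ≤ 1`. This allows terms free of `L` to be absorbed.
listSize-positive : ∀ {q N L T ε} {C : Code q N} → ε ≤ 1ℚ → ListDecoder C ε L T → 1 ℕ.≤ L
listSize-positive {N = N} {ε = ε} {C} ε≤1 D =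
  ℕ.≤-trans (∈⇒0<length (Equivalence.from (correct _ j) (0 , 0 , 0≤radius , 0≤radius , done)))
            (listSize (codeword C j))
  where
  open ListDecoder D
  j : Fin (size C)
  -- The first codeword, which exists because the code is nonempty.
  j = fromℕ< (ℕ.>-nonZero⁻¹ (size C) {{nonempty C}})
  0≤1-ε : 0ℚ ≤ 1ℚ - ε
  0≤1-ε = subst (_≤ 1ℚ - ε) (ℚ.+-inverseʳ ε) (ℚ.+-monoˡ-≤ (- ε) ε≤1)
  0≤radius : fromℕ 0 ≤ fromℕ N * (1ℚ - ε)
  0≤radius = begin
    0ℚ                  ≡⟨ ℚ.*-zeroʳ (fromℕ N) ⟨
    fromℕ N * 0ℚ        ≤⟨ *-monoˡ-≤-fromℕ N 0≤1-ε ⟩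
    fromℕ N * (1ℚ - ε)  ∎
    where open ℚ.≤-Reasoning

-- Instantiated with `u` as n/N, `w` as 1/ε, `X` as NL and `z` as n log log n. The factor 3 from the
-- window size joins `J` in one constant common to both summands.
fromℕ-cost-bound : ∀ {B t J X V z : ℕ} {u w : ℚ} → 1 ℕ.≤ J → fromℕ B ≤ u → fromℕ V ≤ fromℕ 3 * w →
  fromℕ (B ℕ.* t ℕ.+ J ℕ.* (X ℕ.* V ℕ.* z)) ≤ fromℕ (J ℕ.* 3) * (u * fromℕ t + (fromℕ X * w) * fromℕ z)
fromℕ-cost-bound {B} {t} {J@(suc _)} {X} {V} {z} {u} {w} _ B≤u V≤3w = begin
  fromℕ (B ℕ.* t ℕ.+ J ℕ.* (X ℕ.* V ℕ.* z))
    -- The decoding term is inflated by `J * 3`, which is nonzero, to match the constant of the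
    -- other term.
    ≤⟨ fromℕ-mono-≤ (ℕ.+-monoˡ-≤ (J ℕ.* (X ℕ.* V ℕ.* z)) (ℕ.m≤n*m (B ℕ.* t) (J ℕ.* 3))) ⟩
  fromℕ (J ℕ.* 3 ℕ.* (B ℕ.* t) ℕ.+ J ℕ.* (X ℕ.* V ℕ.* z))
    ≡⟨ trans (fromℕ-+ (J ℕ.* 3 ℕ.* (B ℕ.* t)) _) (cong₂ _+_
         (trans (fromℕ-* (J ℕ.* 3) (B ℕ.* t)) (cong (fromℕ (J ℕ.* 3) *_) (fromℕ-* B t)))
         (trans (fromℕ-* J (X ℕ.* V ℕ.* z)) (cong (fromℕ J *_)
           (trans (fromℕ-* (X ℕ.* V) z) (cong (_* fromℕ z) (fromℕ-* X V)))))) ⟩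
  fromℕ (J ℕ.* 3) * (fromℕ B * fromℕ t) + fromℕ J * (fromℕ X * fromℕ V * fromℕ z)
    ≤⟨ ℚ.+-mono-≤
         (*-monoˡ-≤-fromℕ (J ℕ.* 3) (*-monoʳ-≤-fromℕ t B≤u))
         (*-monoˡ-≤-fromℕ J (*-monoʳ-≤-fromℕ z (*-monoˡ-≤-fromℕ X V≤3w))) ⟩
  fromℕ (J ℕ.* 3) * (u * fromℕ t) + fromℕ J * (fromℕ X * (fromℕ 3 * w) * fromℕ z)
    ≡⟨ cong (λ k → k * (u * fromℕ t) + fromℕ J * (fromℕ X * (fromℕ 3 * w) * fromℕ z)) (fromℕ-* J 3) ⟩
  fromℕ J * fromℕ 3 * (u * fromℕ t) + fromℕ J * (fromℕ X * (fromℕ 3 * w) * fromℕ z)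
    ≡⟨ solve 7 (λ j h u t x w z → j :* h :* (u :* t) :+ j :* (x :* (h :* w) :* z)
                               := j :* h :* (u :* t :+ (x :* w) :* z)) refl
         (fromℕ J) (fromℕ 3) u (fromℕ t) (fromℕ X) w (fromℕ z) ⟩
  fromℕ J * fromℕ 3 * (u * fromℕ t + (fromℕ X * w) * fromℕ z)
    ≡⟨ cong (_* (u * fromℕ t + (fromℕ X * w) * fromℕ z)) (fromℕ-* J 3) ⟨
  fromℕ (J ℕ.* 3) * (u * fromℕ t + (fromℕ X * w) * fromℕ z) ∎
  where
  open ℚ.≤-Reasoning
  open +-*-Solver

-- The running time with explicit constants

edApprox-time : (hs : HuntSzymanski) → ∀ {c n₁} →
  (∀ {a b} (G : Graph a b) → n₁ ℕ.≤ a ⊔ b →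
     cost (HuntSzymanski.run hs G) ℕ.≤ c ℕ.* ((a ⊔ b ℕ.+ length G) ℕ.* loglog (a ⊔ b))) →
  (ε : ℚ) .{{_ : Positive ε}} → ε < 1ℚ →
  (q N L : ℕ) .{{_ : NonZero N}} (T : ℕ → ℕ)
  (C : Code q N) (D : ListDecoder C ε L T)
  (A : Set) (_≟_ : DecidableEquality A)
  (m : Vec A (size C ℕ.* N))
  (n′ : ℕ) (S′ : Vec (A × Fin q) n′) →
  let S = indexed C m
      n = (size C ℕ.* N) ⊔ n′
  in n₁ ⊔ 4 ℕ.≤ n →
     fromℕ (cost (edApprox _≟_ ε N S S′ (ListDecoder.decode D) hs))
       ≤ fromℕ ((18 ℕ.+ 2 ℕ.* c) ℕ.* 3) * ((+ n / N) * fromℕ (T N)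
                     + (fromℕ (N ℕ.* L) * inverse ε) * fromℕ (n ℕ.* loglog n))
edApprox-time hs {c} {n₁} hsTime ε ε<1 q N L T C D A _≟_ m n′ S′ n₀≤n =
  ℚ.≤-trans {fromℕ total} {fromℕ bound} (fromℕ-mono-≤ {total} {bound} total≤bound) bound≤
  where
  open ListDecoder D
  n B V J total bound : ℕ
  n = (size C ℕ.* N) ⊔ n′
  B = n′ ℕ./ N
  V = windowSize ℤ.∣ floor (inverse ε) ∣
  J = 18 ℕ.+ 2 ℕ.* c
  total = cost (edApprox _≟_ ε N (indexed C m) S′ decode hs)
  bound = B ℕ.* T N ℕ.+ J ℕ.* (N ℕ.* L ℕ.* V ℕ.* (n ℕ.* loglog n))
  n′≤n : n′ ℕ.≤ n
  n′≤n = ℕ.m≤n⊔m (size C ℕ.* N) n′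
  ε≤1 : ε ≤ 1ℚ
  ε≤1 = ℚ.<⇒≤ ε<1
  4≤n : 4 ℕ.≤ n
  4≤n = ℕ.m⊔n≤o⇒n≤o n₁ 4 n₀≤n
  BN≤n : B ℕ.* N ℕ.≤ n
  BN≤n = ℕ.≤-trans (m/n*n≤m n′ N) n′≤n
  total≤bound : total ℕ.≤ bound
  total≤bound = ℕ.≤-trans
    (edApprox-cost _≟_ ε N (indexed C m) S′ decode hs {L} {T N} {c} {n₁}
      listSize time hsTime (ℕ.m⊔n≤o⇒m≤o n₁ 4 n₀≤n))
    (totalCost-bound {N} {L} {V} {B} {size C ℕ.* N} {n′} {n} {loglog n} (T N) c
      (ℕ.>-nonZero⁻¹ N) (listSize-positive ε≤1 D) (s≤s z≤n) (ℕ.≤-trans (s≤s z≤n) 4≤n)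
      (loglog-positive 4≤n) BN≤n (ℕ.m≤m⊔n (size C ℕ.* N) n′) n′≤n)
  bound≤ : fromℕ bound ≤ fromℕ (J ℕ.* 3) * ((+ n / N) * fromℕ (T N)
                           + (fromℕ (N ℕ.* L) * inverse ε) * fromℕ (n ℕ.* loglog n))
  bound≤ = fromℕ-cost-bound {B} {T N} {J} {N ℕ.* L} {V} {n ℕ.* loglog n} {+ n / N} {inverse ε}
    (s≤s z≤n) (fromℕ≤/ {B} {n} N BN≤n) (windowSize-bound ε ε≤1)

theorem4p1 : (hs : HuntSzymanski) →
  ∃[ ε₀ ] 0ℚ < ε₀ × (∃[ K ] ∃[ n₀ ]
    ((ε : ℚ) .{{_ : Positive ε}} → ε < ε₀ →
     (q N L : ℕ) .{{_ : NonZero N}} (T : ℕ → ℕ)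
     (C : Code q N) (D : ListDecoder C ε L T)
     (A : Set) (_≟_ : DecidableEquality A)
     (m : Vec A (size C ℕ.* N))
     (n′ : ℕ) (S′ : Vec (A × Fin q) n′) →
     let S = indexed C m
         n = (size C ℕ.* N) ⊔ n′
     in n₀ ℕ.≤ n →
        fromℕ (cost (edApprox _≟_ ε N S S′ (ListDecoder.decode D) hs))
          ≤ fromℕ K * ((+ n / N) * fromℕ (T N)
                        + (fromℕ (N ℕ.* L) * inverse ε) * fromℕ (n ℕ.* loglog n))))
theorem4p1 hs =
  let c , n₁ , hsTime = HuntSzymanski.time hs
  -- With `ε₀ = 1`, both 1/ε ≥ 1 and a nonnegative decoding radius follow. The threshold combines
  -- that of Hunt-Szymanski with 4, from which on `loglog` is at least 1. The constant depends only
  -- on the Hunt-Szymanski constant `c`.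
  in 1ℚ , *<* (ℤ.+<+ (s≤s z≤n)) , (18 ℕ.+ 2 ℕ.* c) ℕ.* 3 , n₁ ⊔ 4 , edApprox-time hs {c} {n₁} hsTime
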